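{- For all integers $j,k\ge0$, $$A_{j,k,1}=2k\,D_{2j,k}+8(j-k+1)\,D_{2j,k-1}.$$
   Context: For $n\ge1$, $\mathfrak B_n$ is the hyperoctahedral group of signed permutations: words $\pi=\pi_1\cdots\pi_n$ of nonzero integers such that $|\pi_1|,\dots,|\pi_n|$ is a permutation of $[n]=\{1,\dots,n\}$, with $\pi(i)=\pi_i$, $\pi(-i)=-\pi(i)$. $\mathcal I_n^B$ is the set of $\pi\in\mathfrak B_n$ with $\pi^2=\mathrm{id}$ (for $n=0$, a single empty involution). With $\pi_0=0$ and the usual order on $\mathbb Z$, $\operatorname{des}^B(\pi)=\#\{0\le i\le n-1:\pi_i>\pi_{i+1}\}$, and $\operatorname{fix}_B(\pi)=\#\{i\in[n]:|\pi(i)|=i\}$. Let $J_{2j}^B(t)=\sum t^{\operatorname{des}^B(\pi)}$ over $\pi\in\mathcal I_{2j}^B$ with $\operatorname{fix}_B(\pi)=0$, and let $P_j(x)=\sum_{s=0}^jD_{2j,s}x^s$ be the unique polynomial with $J_{2j}^B(t)=(1+t)^{2j}P_j\!\left(\frac{t}{(1+t)^2}\right)$ (it exists because $J_{2j}^B$ is palindromic with center $j$). Convention: $D_{2j,s}=0$ for $s<0$ or $s>j$. The numbers $A_{j,k,r}$ are the coefficients in $A_{j,r}(x)=\sum_kA_{j,k,r}x^k$, where $$\sum_{r\ge0}A_{j,r}(x)W^r=(1+4xW)^{2j}\,P_j\!\left(\frac{x(1+2W+4xW^2)}{(1+4xW)^2}\right).$$ -}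

module Defs where

open import Algebra.Bundles.Raw using (RawRing)
import Algebra.Definitions.RawSemiring as RawSemiringDefinitions
open import Data.Fin.Base as Fin using (Fin; toℕ; inject₁; fromℕ<)
import Data.Fin.Properties as Fin
open import Data.Integer.Base as ℤ using (ℤ; +_; -[1+_]; _◃_; +-*-rawRing)
import Data.Integer.Properties as ℤ
open import Data.List.Base as List using (List; []; _∷_)
open import Data.Nat.Base as ℕ using (ℕ; zero; suc; _∸_)
import Data.Nat.Properties as ℕ
open import Data.Product.Base using (_×_; _,_; proj₁; proj₂)
import Data.Product.Properties as Product
open import Data.Sign.Base as Sign using (Sign)
import Data.Sign.Properties as Sign
open import Data.Vec.Base as Vec using (Vec; []; _∷_; lookup)
open import Data.Vec.Functional using (Vector)
open import Function.Base using (_∘_)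
open import Function.Definitions using (Bijective; Injective; Surjective)
open import Level using (0ℓ)
open import Relation.Binary.PropositionalEquality using (_≡_; refl)
open import Relation.Nullary.Decidable using (Dec; yes; no; map′; _×-dec_; _→-dec_)

-- The set {±1, …, ±n}; the pair (s , i) stands for s (i + 1), since Fin n
-- starts at 0.
Letter : ℕ → Set
Letter n = Sign × Fin n

value : ∀ {n} → Letter n → ℤ
value (s , i) = s ◃ suc (toℕ i)

Word : ℕ → Set
Word n = Vec (Letter n) n

∣_∣ʷ : ∀ {n} → Word n → Fin n → Fin n
∣ π ∣ʷ i = proj₂ (lookup π i)

IsSignedPermutation : ∀ {n} → Word n → Set
IsSignedPermutation π = Bijective _≡_ _≡_ ∣ π ∣ʷ

-- The action of π on {±1, …, ±n}, extended by π(-i) = -π(i).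
_⟨_⟩ : ∀ {n} → Word n → Letter n → Letter n
π ⟨ s , i ⟩ = s Sign.* proj₁ (lookup π i) , proj₂ (lookup π i)

IsInvolution : ∀ {n} → Word n → Set
IsInvolution π = ∀ a → π ⟨ π ⟨ a ⟩ ⟩ ≡ a

isSignedPermutation? : ∀ {n} (π : Word n) → Dec (IsSignedPermutation π)
isSignedPermutation? π = injective? ×-dec surjective?
  where
  injective? : Dec (Injective _≡_ _≡_ ∣ π ∣ʷ)
  injective? = map′ (λ inj {i} {k} → inj i k) (λ inj i k → inj)
    (Fin.all? λ i → Fin.all? λ k → (∣ π ∣ʷ i Fin.≟ ∣ π ∣ʷ k) →-dec (i Fin.≟ k))

  surjective? : Dec (Surjective _≡_ _≡_ ∣ π ∣ʷ)
  surjective? = map′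
    (λ surj k → proj₁ (surj k) , λ { refl → proj₂ (surj k) })
    (λ surj k → proj₁ (surj k) , proj₂ (surj k) refl)
    (Fin.all? λ k → Fin.any? λ i → ∣ π ∣ʷ i Fin.≟ k)

isInvolution? : ∀ {n} (π : Word n) → Dec (IsInvolution π)
isInvolution? π = map′
  (λ { (p , m) (Sign.+ , i) → p i ; (p , m) (Sign.- , i) → m i })
  (λ inv → (λ i → inv (Sign.+ , i)) , (λ i → inv (Sign.- , i)))
  (Fin.all? (λ i → fixes? (Sign.+ , i)) ×-dec Fin.all? (λ i → fixes? (Sign.- , i)))
  where
  fixes? : ∀ a → Dec (π ⟨ π ⟨ a ⟩ ⟩ ≡ a)
  fixes? a = Product.≡-dec Sign._≟_ Fin._≟_ (π ⟨ π ⟨ a ⟩ ⟩) a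

letters : ∀ n → List (Letter n)
letters n = List.cartesianProduct (Sign.+ ∷ Sign.- ∷ []) (List.allFin n)

-- All vectors of length m over a list, each listed once if the list has no
-- repetitions.
vectors : ∀ {A : Set} → List A → ∀ m → List (Vec A m)
vectors as zero    = [] ∷ []
vectors as (suc m) = List.cartesianProductWith _∷_ as (vectors as m)

𝔅 : ∀ n → List (Word n)
𝔅 n = List.filter isSignedPermutation? (vectors (letters n) n)

𝓘ᴮ : ∀ n → List (Word n)
𝓘ᴮ n = List.filter isInvolution? (𝔅 n)

values₀ : ∀ {n} → Word n → Vec ℤ (suc n)
values₀ π = + 0 ∷ Vec.map value π

desᴮ : ∀ {n} → Word n → ℕ
desᴮ {n} π = List.length (List.filter descent? (List.allFin n))
  where
  descent? : (i : Fin n) →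
             Dec (lookup (values₀ π) (Fin.suc i) ℤ.< lookup (values₀ π) (inject₁ i))
  descent? i = lookup (values₀ π) (Fin.suc i) ℤ.<? lookup (values₀ π) (inject₁ i)

fixᴮ : ∀ {n} → Word n → ℕ
fixᴮ {n} π = List.length (List.filter (λ i → ∣ π ∣ʷ i Fin.≟ i) (List.allFin n))

module PowerSeries (R : RawRing 0ℓ 0ℓ) where
  open RawRing R
  open RawSemiringDefinitions rawSemiring using (sum)

  -- The n-th value is the coefficient of the n-th power of the variable.
  Series : Set
  Series = ℕ → Carrier

  constant : Carrier → Series
  constant c zero    = c
  constant c (suc n) = 0#

  indeterminate : Series
  indeterminate (suc zero) = 1#
  indeterminate _          = 0#

  seriesRing : RawRing 0ℓ 0ℓ
  seriesRing = record
    { Carrier = Series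
    ; _≈_     = λ f g → ∀ n → f n ≈ g n
    ; _+_     = λ f g n → f n + g n
    ; _*_     = λ f g n → sum {suc n} (λ i → f (toℕ i) * g (n ∸ toℕ i))
    ; -_      = λ f n → - f n
    ; 0#      = constant 0#
    ; 1#      = constant 1#
    }

  private
    module S where
      open RawRing seriesRing public
      open RawSemiringDefinitions (RawRing.rawSemiring seriesRing) public using (_^_)

  -- The reciprocal of a series with constant coefficient 1, as the geometric
  -- series Σᵢ (1 - f)ⁱ: only the terms with i ≤ n contribute to the n-th
  -- coefficient.  It has no meaning for other constant coefficients.
  _⁻¹ : Series → Series
  (f ⁻¹) n = sum {suc n} (λ i → ((S.1# S.+ S.- f) S.^ toℕ i) n)

-- Σₛ Dₛ yˢ in a ring R, where ι sends the integer coefficients to R.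
evaluate : (R : RawRing 0ℓ 0ℓ) → (ℤ → RawRing.Carrier R) →
           ∀ {m} → Vector ℤ m → RawRing.Carrier R → RawRing.Carrier R
evaluate R ι D y = sum (λ s → ι (D s) * y ^ toℕ s)
  where
  open RawRing R
  open RawSemiringDefinitions rawSemiring

module ℤ[[t]] where
  open PowerSeries +-*-rawRing public
  open RawRing seriesRing public
  open RawSemiringDefinitions rawSemiring public using (_^_)

  t : Series
  t = indeterminate

Jᴮ : ℕ → ℤ[[t]].Series
Jᴮ n = List.foldr _+_ 0# (List.map (λ π → t ^ desᴮ π) fixedPointFree)
  where
  open ℤ[[t]]

  fixedPointFree : List (Word n)
  fixedPointFree = List.filter (λ π → fixᴮ π ℕ.≟ 0) (𝓘ᴮ n)

-- J₂ⱼ(t) = (1 + t)²ʲ P(t / (1 + t)²), where P = Σ_{s ≤ j} D s xˢ.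
IsP : ∀ j → Vector ℤ (suc j) → Set
IsP j D = Jᴮ (2 ℕ.* j)
        ≈ (1# + t) ^ (2 ℕ.* j) * evaluate seriesRing constant D (t * ((1# + t) ^ 2) ⁻¹)
  where open ℤ[[t]]

-- Dₛ for any integer s, with Dₛ = 0 unless 0 ≤ s ≤ j.
coefficient : ∀ {j} → Vector ℤ (suc j) → ℤ → ℤ
coefficient     D -[1+ _ ] = + 0
coefficient {j} D (+ s) with s ℕ.<? suc j
... | yes s<1+j = D (fromℕ< s<1+j)
... | no  _     = + 0

module ℤ[[x]][[W]] where
  module ℤ[[x]] = PowerSeries +-*-rawRing
  open PowerSeries ℤ[[x]].seriesRing public
  open RawRing seriesRing public
  open RawSemiringDefinitions rawSemiring public using (_^_)

  ι : ℤ → Series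
  ι c = constant (ℤ[[x]].constant c)

  x W : Series
  x = constant ℤ[[x]].indeterminate
  W = indeterminate

-- (1 + 4xW)²ʲ P(x (1 + 2W + 4xW²) / (1 + 4xW)²) = Σᵣ Aⱼ,ᵣ(x) Wʳ; applied to r and then
-- k, it gives the coefficient of xᵏ in Aⱼ,ᵣ(x).
generatingA : ∀ j → Vector ℤ (suc j) → ℤ[[x]][[W]].Series
generatingA j D =
  (1# + ι (+ 4) * x * W) ^ (2 ℕ.* j) *
  evaluate seriesRing ι D
    (x * (1# + ι (+ 2) * W + ι (+ 4) * x * W ^ 2) * ((1# + ι (+ 4) * x * W) ^ 2) ⁻¹)
  where open ℤ[[x]][[W]]

A : ∀ j → Vector ℤ (suc j) → (k r : ℕ) → ℤ
A j D k r = generatingA j D r k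

{-# OPTIONS --safe #-}

-- Everything takes place modulo W².  There 1 + 4xW has the powers 1 + 4nxW, and the
-- argument of P is y = x + (2x - 8x²)W = x + ∂x W for the derivation
-- ∂ = (2 - 8x) x d/dx.  Hence P(y) = P(x) + ∂P(x) W, and the coefficient of W in the
-- generating function is ∂P(x) + 8jx P(x).
module Submission where

open import Defs renaming (module ℤ[[x]][[W]] to XW)
open import Algebra.Bundles.Raw using (RawRing)
import Algebra.Definitions.RawSemiring as RawSemiringDefinitions
open import Data.Fin.Base using (Fin; zero; suc; toℕ; fromℕ<)
open import Data.Fin.Properties using (toℕ-fromℕ<)
open import Data.Integer.Base using (ℤ; +_; _+_; _-_; _*_; -_; +-*-rawRing)
import Data.Integer.Properties as ℤ
open import Data.Integer.Tactic.RingSolver using (solve-∀)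
open import Data.Nat.Base as ℕ using (ℕ; zero; suc)
import Data.Nat.Properties as ℕ
open import Data.Vec.Functional using (Vector)
open import Function.Base using (_∘_)
open import Relation.Binary.PropositionalEquality
  using (_≡_; _≗_; refl; sym; trans; cong; cong₂; module ≡-Reasoning)
open import Relation.Nullary.Decidable using (yes; no)

open ≡-Reasoning

-- Arithmetic of power series in x with integer coefficients.

module X where
  open PowerSeries +-*-rawRing public
  open RawRing seriesRing public
  open RawSemiringDefinitions rawSemiring public using (_^_)

sum : ∀ {n} → Vector ℤ n → ℤ
sum = RawSemiringDefinitions.sum (RawRing.rawSemiring +-*-rawRing)

-- Multiplication by x, written by cases so that its coefficients compute.
shift : X.Series → X.Series
shift f zero    = + 0
shift f (suc n) = f n

0#-coefficient : X.0# ≗ λ _ → + 0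
0#-coefficient zero    = refl
0#-coefficient (suc n) = refl

-- The convolution unfolds by computation: coefficient `suc n` of `f X.* g` is `f 0 * g (suc n)`
-- plus coefficient `n` of `(f ∘ suc) X.* g`. The inductions on products below rest on this.
*-cong : ∀ {f f′ g g′} → f ≗ f′ → g ≗ g′ → f X.* g ≗ f′ X.* g′
*-cong p q zero    = cong₂ (λ a b → a * b + + 0) (p 0) (q 0)
*-cong p q (suc n) = cong₂ _+_ (cong₂ _*_ (p 0) (q (suc n))) (*-cong (p ∘ suc) q n)

*-congˡ : ∀ {f f′} g → f ≗ f′ → f X.* g ≗ f′ X.* g
*-congˡ g p = *-cong {g = g} p (λ _ → refl)

+-zeroʳ : ∀ {a b c} → a ≡ c → b ≡ + 0 → a + b ≡ c
+-zeroʳ refl refl = ℤ.+-identityʳ _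

+-zeroˡ : ∀ {a b c} → a ≡ + 0 → b ≡ c → a + b ≡ c
+-zeroˡ refl refl = ℤ.+-identityˡ _

-- Phrased with the constantly zero function instead of `X.0#`, because the tail
-- `X.constant c ∘ suc` reduces to that function, whereas `X.0#` is defined by cases.
zero-* : ∀ g → (λ _ → + 0) X.* g ≗ λ _ → + 0
zero-* g zero    = refl
zero-* g (suc n) = trans (ℤ.+-identityˡ _) (zero-* g n)

constant-* : ∀ c g → X.constant c X.* g ≗ λ n → c * g n
constant-* c g zero    = ℤ.+-identityʳ _
constant-* c g (suc n) =
  trans (cong (λ z → c * g (suc n) + z) (zero-* g n)) (ℤ.+-identityʳ _)

shift-* : ∀ f g → shift f X.* g ≗ shift (f X.* g)
shift-* f g zero    = refl
shift-* f g (suc n) = ℤ.+-identityˡ _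

*-zeroʳ : ∀ f → f X.* X.0# ≗ λ _ → + 0
*-zeroʳ f zero    = trans (ℤ.+-identityʳ _) (ℤ.*-zeroʳ (f 0))
*-zeroʳ f (suc n) = cong₂ _+_ (ℤ.*-zeroʳ (f 0)) (*-zeroʳ (f ∘ suc) n)

*-identityʳ : ∀ f → f X.* X.1# ≗ f
*-identityʳ f zero    = trans (ℤ.+-identityʳ _) (ℤ.*-identityʳ (f 0))
*-identityʳ f (suc n) = trans
  (cong₂ _+_ (ℤ.*-zeroʳ (f 0)) (*-identityʳ (f ∘ suc) n)) (ℤ.+-identityˡ _)

*-identityˡ : ∀ f → X.1# X.* f ≗ f
*-identityˡ f n = trans (constant-* (+ 1) f n) (ℤ.*-identityˡ (f n))

indeterminate≗shift : X.indeterminate ≗ shift X.1#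
indeterminate≗shift zero          = refl
indeterminate≗shift (suc zero)    = refl
indeterminate≗shift (suc (suc n)) = refl

shift-cong : ∀ {f g} → f ≗ g → shift f ≗ shift g
shift-cong p zero    = refl
shift-cong p (suc n) = p n

indeterminate-* : ∀ f → X.indeterminate X.* f ≗ shift f
indeterminate-* f n = begin
  (X.indeterminate X.* f) n  ≡⟨ *-congˡ f indeterminate≗shift n ⟩
  (shift X.1# X.* f) n       ≡⟨ shift-* X.1# f n ⟩
  shift (X.1# X.* f) n       ≡⟨ shift-cong (*-identityˡ f) n ⟩
  shift f n                  ∎

-- Series modulo W².

-- F = a + bW modulo W². The parts are compared pointwise, so each can be replaced by a simpler form
-- of the same series.
record HasJet (F : XW.Series) (a b : X.Series) : Set where
  constructor _,_
  field
    constantPart : F 0 ≗ a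
    linearPart   : F 1 ≗ b

open HasJet

jet-cong : ∀ {F a a′ b b′} → HasJet F a b → a ≗ a′ → b ≗ b′ → HasJet F a′ b′
jet-cong (F₀ , F₁) p q = (λ k → trans (F₀ k) (p k)) , (λ k → trans (F₁ k) (q k))

jet-+ : ∀ F G {a b c d} → HasJet F a b → HasJet G c d →
        HasJet (F XW.+ G) (λ k → a k + c k) (λ k → b k + d k)
jet-+ _ _ (F₀ , F₁) (G₀ , G₁) =
  (λ k → cong₂ _+_ (F₀ k) (G₀ k)) , (λ k → cong₂ _+_ (F₁ k) (G₁ k))

-- (a + bW)(c + dW) = ac + (ad + bc)W. The `X.0#` removed from each coefficient is the empty sum at
-- the end of the convolution.
jet-* : ∀ F G {a b c d} → HasJet F a b → HasJet G c d →
        HasJet (F XW.* G) (a X.* c) (λ k → (a X.* d) k + (b X.* c) k)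
jet-* _ _ (F₀ , F₁) (G₀ , G₁) =
  (λ k → +-zeroʳ (*-cong F₀ G₀ k) (0#-coefficient k)) ,
  (λ k → cong₂ _+_ (*-cong F₀ G₁ k) (+-zeroʳ (*-cong F₁ G₀ k) (0#-coefficient k)))

jet-constant : ∀ a → HasJet (XW.constant a) a (λ _ → + 0)
jet-constant a = (λ _ → refl) , 0#-coefficient

jet-constant-* : ∀ a F {b c} → HasJet F b c →
                 HasJet (XW.constant a XW.* F) (a X.* b) (a X.* c)
jet-constant-* a F {b} {c} jet = jet-cong (jet-* (XW.constant a) F (jet-constant a) jet)
  (λ _ → refl)
  (λ k → trans (cong (λ z → (a X.* c) k + z) (zero-* b k)) (ℤ.+-identityʳ _))

jet-W : HasJet XW.W X.0# X.1#
jet-W = (λ _ → refl) , (λ _ → refl)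

jet-*W : ∀ F {a b} → HasJet F a b → HasJet (F XW.* XW.W) (λ _ → + 0) a
jet-*W F {a} {b} jet = jet-cong (jet-* F XW.W jet jet-W)
  (*-zeroʳ a)
  (λ k → +-zeroʳ (*-identityʳ a k) (*-zeroʳ b k))

jet-W² : HasJet (XW.W XW.^ 2) X.0# X.0#
jet-W² = jet-cong (jet-* XW.W (XW.W XW.^ 1) jet-W (jet-* XW.W XW.1# jet-W (jet-constant X.1#)))
  (λ k → trans (constant-* (+ 0) (X.0# X.* X.1#) k) (sym (0#-coefficient k)))
  (λ k → +-zeroˡ
    (constant-* (+ 0) (λ k → (X.0# X.* (λ _ → + 0)) k + (X.1# X.* X.1#) k) k)
    (trans (*-identityˡ (X.0# X.* X.1#) k) (*-identityʳ X.0# k)))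

jet-*W² : ∀ F {a b} → HasJet F a b →
          HasJet (F XW.* XW.W XW.^ 2) (λ _ → + 0) (λ _ → + 0)
jet-*W² F {a} {b} jet = jet-cong (jet-* F (XW.W XW.^ 2) jet jet-W²)
  (*-zeroʳ a)
  (λ k → cong₂ _+_ (*-zeroʳ a k) (*-zeroʳ b k))

-- The binomial theorem modulo W², by induction on the exponent.
jet-^ : ∀ F n {b} → HasJet F X.1# b → HasJet (F XW.^ n) X.1# (λ k → + n * b k)
jet-^ F zero        jet = jet-constant X.1#
jet-^ F (suc n) {b} jet = jet-cong (jet-* F (F XW.^ n) jet (jet-^ F n jet))
  (*-identityˡ X.1#)
  (λ k → trans (cong₂ _+_ (*-identityˡ (λ k → + n * b k) k) (*-identityʳ b k))
               (step (+ n) (b k)))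
  where
  step : ∀ n b → n * b + b ≡ (+ 1 + n) * b
  step = solve-∀

-- 1 - F has no constant part, so modulo W² the geometric series is 1 + (1 - F).
jet-⁻¹ : ∀ F {b} → HasJet F X.1# b → HasJet (F XW.⁻¹) X.1# (λ k → - b k)
jet-⁻¹ F {b} (F₀ , F₁) =
  (λ k → trans (cong (λ z → X.1# k + z) (0#-coefficient k)) (ℤ.+-identityʳ _)) ,
  -- The sum for W¹ has the terms i = 0 and i = 1: the former is the W-coefficient of 1, hence zero,
  -- and the latter is that of 1 - F.
  (λ k → +-zeroˡ (0#-coefficient k) (+-zeroʳ (linearPart jet k) (0#-coefficient k)))
  where
  1-F : XW.Series
  1-F = XW.1# XW.+ XW.- F

  jet-1-F : HasJet 1-F (λ _ → + 0) (λ k → - b k)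
  jet-1-F =
    (λ k → trans (cong (λ z → X.1# k - z) (F₀ k)) (ℤ.+-inverseʳ (X.1# k))) ,
    (λ k → trans (cong₂ _-_ (0#-coefficient k) (F₁ k)) (ℤ.+-identityˡ _))

  jet : HasJet (1-F XW.^ 1) (λ _ → + 0) (λ k → - b k)
  jet = jet-cong (jet-* 1-F XW.1# jet-1-F (jet-constant X.1#))
    (zero-* X.1#)
    (λ k → +-zeroˡ (zero-* (λ _ → + 0) k) (*-identityʳ (λ k → - b k) k))

-- Jets of 1 + 4xW and of the argument of P.

jet-4x : HasJet (XW.ι (+ 4) XW.* XW.x) (λ k → + 4 * X.indeterminate k) (λ _ → + 0)
jet-4x = jet-cong
  (jet-constant-* (X.constant (+ 4)) XW.x (jet-constant X.indeterminate))
  (constant-* (+ 4) X.indeterminate)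
  (λ k → trans (constant-* (+ 4) (λ _ → + 0) k) (ℤ.*-zeroʳ (+ 4)))

1+4xW : XW.Series
1+4xW = XW.1# XW.+ XW.ι (+ 4) XW.* XW.x XW.* XW.W

jet-1+4xW : HasJet 1+4xW X.1# (λ k → + 4 * X.indeterminate k)
jet-1+4xW = jet-cong jet (λ _ → ℤ.+-identityʳ _) (λ _ → ℤ.+-identityˡ _)
  where
  jet = jet-+ _ _ (jet-constant X.1#) (jet-*W _ jet-4x)

numerator : XW.Series
numerator = XW.1# XW.+ XW.ι (+ 2) XW.* XW.W XW.+ XW.ι (+ 4) XW.* XW.x XW.* XW.W XW.^ 2

jet-numerator : HasJet numerator X.1# (X.constant (+ 2))
jet-numerator = jet-cong jet
  (λ _ → trans (ℤ.+-identityʳ _) (ℤ.+-identityʳ _))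
  (λ _ → trans (ℤ.+-identityʳ _) (ℤ.+-identityˡ _))
  where
  jet = jet-+ _ _
    (jet-+ _ _ (jet-constant X.1#) (jet-*W _ (jet-constant (X.constant (+ 2)))))
    (jet-*W² _ jet-4x)

-- Spelled out as in generatingA, since numerator and 1+4xW here would make
-- jet-generatingA a costly conversion between unfolded products.
y : XW.Series
y = XW.x XW.* (XW.1# XW.+ XW.ι (+ 2) XW.* XW.W XW.+ XW.ι (+ 4) XW.* XW.x XW.* XW.W XW.^ 2)
         XW.* ((XW.1# XW.+ XW.ι (+ 4) XW.* XW.x XW.* XW.W) XW.^ 2) XW.⁻¹

2-8x : X.Series
2-8x k = X.constant (+ 2) k + - + 8 * X.indeterminate k

-- Modulo W² the term 4xW² disappears and the inverse of (1 + 4xW)² is 1 - 8xW, so the product is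
-- x(1 + 2W)(1 - 8xW), with W-coefficient 2x - 8x².
jet-y : HasJet y X.indeterminate (shift 2-8x)
jet-y = jet-cong jet
  (λ k → trans (*-identityʳ (X.indeterminate X.* X.1#) k) (*-identityʳ X.indeterminate k))
  (λ k → trans
    (cong₂ _+_
      (trans (*-congˡ -8x (*-identityʳ X.indeterminate) k) (indeterminate-* -8x k))
      (trans (*-identityʳ (X.indeterminate X.* X.constant (+ 2)) k)
             (indeterminate-* (X.constant (+ 2)) k)))
    (collect k))
  where
  jet = jet-* _ _
    (jet-constant-* X.indeterminate _ jet-numerator)
    (jet-⁻¹ _ (jet-^ _ 2 jet-1+4xW))

  -8x : X.Series
  -8x k = - (+ 2 * (+ 4 * X.indeterminate k))

  rearrange : ∀ a b → - (+ 2 * (+ 4 * a)) + b ≡ b + - + 8 * a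
  rearrange = solve-∀

  collect : ∀ k → shift -8x k + shift (X.constant (+ 2)) k ≡ shift 2-8x k
  collect zero    = refl
  collect (suc k) = rearrange (X.indeterminate k) (X.constant (+ 2) k)

-- The derivation (2 - 8x) x d/dx.

2-8x-* : ∀ f → 2-8x X.* f ≗ λ k → + 2 * f k + - + 8 * shift f k
2-8x-* f zero    = refl
2-8x-* f (suc k) = cong (λ z → + 2 * f (suc k) + z) (begin
  ((2-8x ∘ suc) X.* f) k           ≡⟨ *-congˡ f tail k ⟩
  (X.constant (- + 8) X.* f) k     ≡⟨ constant-* (- + 8) f k ⟩
  - + 8 * f k                      ∎)
  where
  tail : 2-8x ∘ suc ≗ X.constant (- + 8)
  tail zero    = refl
  tail (suc _) = refl

-- Given by coefficients: x d/dx multiplies the coefficient of xᵏ by k, and the factor -8x moves the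
-- result up one degree.
∂ : X.Series → X.Series
∂ f zero    = + 0
∂ f (suc k) = + 2 * + suc k * f (suc k) - + 8 * + k * f k

∂-cong : ∀ {f g} → f ≗ g → ∂ f ≗ ∂ g
∂-cong p zero    = refl
∂-cong p (suc k) = cong₂ (λ a b → + 2 * + suc k * a - + 8 * + k * b) (p (suc k)) (p k)

∂-+ : ∀ f g → ∂ (f X.+ g) ≗ ∂ f X.+ ∂ g
∂-+ f g zero    = refl
∂-+ f g (suc k) = linear (+ suc k) (+ k) (f (suc k)) (g (suc k)) (f k) (g k)
  where
  linear : ∀ m n a b c d → + 2 * m * (a + b) - + 8 * n * (c + d)
           ≡ (+ 2 * m * a - + 8 * n * c) + (+ 2 * m * b - + 8 * n * d)
  linear = solve-∀

∂-scale : ∀ c f → ∂ (λ k → c * f k) ≗ λ k → c * ∂ f k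
∂-scale c f zero    = sym (ℤ.*-zeroʳ c)
∂-scale c f (suc k) = linear c (+ suc k) (+ k) (f (suc k)) (f k)
  where
  linear : ∀ c m n a b → + 2 * m * (c * a) - + 8 * n * (c * b)
           ≡ c * (+ 2 * m * a - + 8 * n * b)
  linear = solve-∀

∂-constant : ∀ c → ∂ (X.constant c) ≗ λ _ → + 0
∂-constant c zero          = refl
∂-constant c (suc zero)    = vanish (+ 1) c
  where
  vanish : ∀ m c → + 2 * m * + 0 - + 8 * + 0 * c ≡ + 0
  vanish = solve-∀
∂-constant c (suc (suc k)) = vanish (+ suc (suc k)) (+ suc k)
  where
  vanish : ∀ m n → + 2 * m * + 0 - + 8 * n * + 0 ≡ + 0
  vanish = solve-∀

-- The Leibniz rule for x times f, with ∂x = x(2 - 8x). In degree k + 2 it comes down to 2(k + 2) =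
-- 2(k + 1) + 2 and 8(k + 1) = 8k + 8.
∂-shift : ∀ f → ∂ (shift f) ≗ shift (λ k → ∂ f k + (2-8x X.* f) k)
∂-shift f zero          = refl
∂-shift f (suc zero)    = leibniz (f 0)
  where
  leibniz : ∀ a → + 2 * + 1 * a - + 8 * + 0 * + 0 ≡ + 0 + (+ 2 * a + + 0)
  leibniz = solve-∀
∂-shift f (suc (suc k)) = trans
  (leibniz (+ k) (f (suc k)) (f k))
  (cong (λ z → ∂ f (suc k) + z) (sym (2-8x-* f (suc k))))
  where
  leibniz : ∀ k a b → + 2 * (+ 2 + k) * a - + 8 * (+ 1 + k) * b
            ≡ + 2 * (+ 1 + k) * a - + 8 * k * b + (+ 2 * a + - + 8 * b)
  leibniz = solve-∀

-- Taylor expansion of P at x to first order.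

-- By induction on s: the product rule for jets and the Leibniz rule for ∂ give the same recursion.
-- Only the jet of `y` enters, so `y` is left arbitrary.
jet-y^ : ∀ y → HasJet y X.indeterminate (shift 2-8x) → ∀ s →
         HasJet (y XW.^ s) (X.indeterminate X.^ s) (∂ (X.indeterminate X.^ s))
jet-y^ y jet zero    = jet-cong (jet-constant X.1#) (λ _ → refl) (λ k → sym (∂-constant (+ 1) k))
jet-y^ y jet (suc s) = jet-cong (jet-* y (y XW.^ s) jet (jet-y^ y jet s))
  (λ _ → refl)
  (λ k → begin
    (X.indeterminate X.* ∂ xˢ) k + (shift 2-8x X.* xˢ) k
      ≡⟨ cong₂ _+_ (indeterminate-* (∂ xˢ) k) (shift-* 2-8x xˢ k) ⟩
    shift (∂ xˢ) k + shift (2-8x X.* xˢ) k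
      ≡⟨ shift-+ k ⟩
    shift (λ k → ∂ xˢ k + (2-8x X.* xˢ) k) k
      ≡⟨ ∂-shift xˢ k ⟨
    ∂ (shift xˢ) k
      ≡⟨ ∂-cong (indeterminate-* xˢ) k ⟨
    ∂ (X.indeterminate X.* xˢ) k ∎)
  where
  xˢ : X.Series
  xˢ = X.indeterminate X.^ s

  shift-+ : ∀ k → shift (∂ xˢ) k + shift (2-8x X.* xˢ) k
                  ≡ shift (λ k → ∂ xˢ k + (2-8x X.* xˢ) k) k
  shift-+ zero    = refl
  shift-+ (suc k) = refl

sumXW : ∀ {n} → Vector XW.Series n → XW.Series
sumXW = RawSemiringDefinitions.sum (RawRing.rawSemiring XW.seriesRing)

-- Additivity of ∂ carries the shape a + ∂a W from the summands to the sum.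
jet-sum : ∀ {n} (F : Vector XW.Series n) (a : Vector X.Series n) →
          (∀ s → HasJet (F s) (a s) (∂ (a s))) →
          HasJet (sumXW F) (λ k → sum (λ s → a s k)) (∂ (λ k → sum (λ s → a s k)))
jet-sum {zero}  F a p = jet-cong (jet-constant X.0#) 0#-coefficient (sym ∘ ∂-zero)
  where
  ∂-zero : ∂ (λ _ → + 0) ≗ λ _ → + 0
  ∂-zero k = trans (sym (∂-cong 0#-coefficient k)) (∂-constant (+ 0) k)
jet-sum {suc n} F a p = jet-cong
  (jet-+ (F zero) (sumXW (F ∘ suc)) (p zero) (jet-sum (F ∘ suc) (a ∘ suc) (p ∘ suc)))
  (λ _ → refl)
  (λ k → sym (∂-+ (a zero) (λ k → sum (λ s → a (suc s) k)) k))

polynomial : ∀ {n} → Vector ℤ n → X.Series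
polynomial D k = sum (λ s → D s * (X.indeterminate X.^ toℕ s) k)

jet-evaluate : ∀ {n} (D : Vector ℤ n) y → HasJet y X.indeterminate (shift 2-8x) →
               HasJet (evaluate XW.seriesRing XW.ι D y) (polynomial D) (∂ (polynomial D))
jet-evaluate D y jet = jet-sum
  (λ s → XW.ι (D s) XW.* y XW.^ toℕ s)
  (λ s k → D s * xˢ s k)
  (λ s → jet-cong
    (jet-constant-* (X.constant (D s)) (y XW.^ toℕ s) (jet-y^ y jet (toℕ s)))
    (constant-* (D s) (xˢ s))
    (λ k → trans (constant-* (D s) (∂ (xˢ s)) k) (sym (∂-scale (D s) (xˢ s) k))))
  where
  xˢ : ∀ {n} → Fin n → X.Series
  xˢ s = X.indeterminate X.^ toℕ s

-- Coefficients of P.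

sum-cong : ∀ {n} {f g : Vector ℤ n} → (∀ i → f i ≡ g i) → sum f ≡ sum g
sum-cong {zero}  p = refl
sum-cong {suc n} p = cong₂ _+_ (p zero) (sum-cong (p ∘ suc))

sum-zero : ∀ {n} {f : Vector ℤ n} → (∀ i → f i ≡ + 0) → sum f ≡ + 0
sum-zero {zero}  p = refl
sum-zero {suc n} p = cong₂ _+_ (p zero) (sum-zero (p ∘ suc))

polynomial-zero : ∀ {n} (D : Vector ℤ (suc n)) → polynomial D 0 ≡ D zero
polynomial-zero D = trans
  (cong₂ _+_ (ℤ.*-identityʳ (D zero))
    (sum-zero (λ s → trans (cong (D (suc s) *_) (indeterminate-* (X.indeterminate X.^ toℕ s) 0)) (ℤ.*-zeroʳ (D (suc s))))))
  (ℤ.+-identityʳ _)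

-- The term s = 0 contributes only in degree 0, and the other terms are divisible by x.
polynomial-suc : ∀ {n} (D : Vector ℤ (suc n)) k →
                 polynomial D (suc k) ≡ polynomial (D ∘ suc) k
polynomial-suc D k = trans
  (cong₂ _+_ (ℤ.*-zeroʳ (D zero))
    (sum-cong (λ s → cong (D (suc s) *_) (indeterminate-* (X.indeterminate X.^ toℕ s) (suc k)))))
  (ℤ.+-identityˡ _)

polynomial-toℕ : ∀ {n} (D : Vector ℤ n) i → polynomial D (toℕ i) ≡ D i
polynomial-toℕ D zero    = polynomial-zero D
polynomial-toℕ D (suc i) = trans (polynomial-suc D (toℕ i)) (polynomial-toℕ (D ∘ suc) i)

polynomial-≥ : ∀ {n} (D : Vector ℤ n) {k} → n ℕ.≤ k → polynomial D k ≡ + 0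
polynomial-≥ D ℕ.z≤n       = refl
polynomial-≥ D (ℕ.s≤s n≤k) = trans (polynomial-suc D _) (polynomial-≥ (D ∘ suc) n≤k)

-- Beyond degree j the convention `coefficient D (+ k)` = 0 agrees with the vanishing coefficients
-- of P.
polynomial≡coefficient : ∀ {j} (D : Vector ℤ (suc j)) k →
                         polynomial D k ≡ coefficient D (+ k)
polynomial≡coefficient {j} D k with k ℕ.<? suc j
... | yes k<1+j = trans (cong (polynomial D) (sym (toℕ-fromℕ< k<1+j)))
                        (polynomial-toℕ D (fromℕ< k<1+j))
... | no  k≮1+j = polynomial-≥ D (ℕ.≮⇒≥ k≮1+j)

-- The coefficient of W in the generating function.

homogenisation : ∀ j → Vector ℤ (suc j) → XW.Series → XW.Series → XW.Series
homogenisation j D u y = u XW.^ (2 ℕ.* j) XW.* evaluate XW.seriesRing XW.ι D y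

-- The W-coefficient of (1 + 8jxW)(P + ∂P W), where 8j = 2j · 4 comes from the power of 1 + 4xW.
jet-homogenisation : ∀ j (D : Vector ℤ (suc j)) →
  HasJet (homogenisation j D 1+4xW y) (polynomial D)
         (λ k → ∂ (polynomial D) k + + 8 * + j * shift (polynomial D) k)
jet-homogenisation j D = jet-cong
  (jet-* (1+4xW XW.^ (2 ℕ.* j)) (evaluate XW.seriesRing XW.ι D y)
    (jet-^ 1+4xW (2 ℕ.* j) jet-1+4xW) (jet-evaluate D y jet-y))
  (*-identityˡ p)
  (λ k → cong₂ _+_ (*-identityˡ (∂ p) k) (begin
    ((λ k → + (2 ℕ.* j) * (+ 4 * X.indeterminate k)) X.* p) k
      ≡⟨ *-congˡ p 8jx k ⟩
    (shift (X.constant (+ 8 * + j)) X.* p) k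
      ≡⟨ shift-* (X.constant (+ 8 * + j)) p k ⟩
    shift (X.constant (+ 8 * + j) X.* p) k
      ≡⟨ shift-cong (constant-* (+ 8 * + j) p) k ⟩
    shift (λ k → + 8 * + j * p k) k
      ≡⟨ scaled k ⟩
    + 8 * + j * shift p k ∎))
  where
  p : X.Series
  p = polynomial D

  8j : ∀ j → + 2 * j * (+ 4 * + 1) ≡ + 8 * j
  8j = solve-∀

  8jx : (λ k → + (2 ℕ.* j) * (+ 4 * X.indeterminate k)) ≗ shift (X.constant (+ 8 * + j))
  8jx zero          = ℤ.*-zeroʳ (+ (2 ℕ.* j))
  8jx (suc zero)    = trans (cong (_* + 4) (ℤ.pos-* 2 j)) (8j (+ j))
  8jx (suc (suc k)) = ℤ.*-zeroʳ (+ (2 ℕ.* j))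

  scaled : ∀ k → shift (λ k → + 8 * + j * p k) k ≡ + 8 * + j * shift p k
  scaled zero    = sym (ℤ.*-zeroʳ (+ 8 * + j))
  scaled (suc k) = refl

jet-generatingA : ∀ j (D : Vector ℤ (suc j)) →
  HasJet (generatingA j D) (polynomial D)
         (λ k → ∂ (polynomial D) k + + 8 * + j * shift (polynomial D) k)
jet-generatingA j D = jet-homogenisation j D

A-linear : ∀ j (D : Vector ℤ (suc j)) k →
     A j D k 1 ≡ ∂ (polynomial D) k + + 8 * + j * shift (polynomial D) k
A-linear j D = linearPart (jet-generatingA j D)

corollary6p1 : ∀ (j k : ℕ) (D : Vector ℤ (suc j)) → IsP j D →
    A j D k 1 ≡ + 2 * + k * coefficient D (+ k)
    + + 8 * (+ j - + k + + 1) * coefficient D (+ k - + 1)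
-- In degree 0 both `∂` and `shift` give zero, and on the right the index `+ 0 - + 1` is negative,
-- where `coefficient` is zero.
corollary6p1 j zero D _ = trans (A-linear j D 0) (vanish (+ j) (coefficient D (+ 0)))
  where
  vanish : ∀ j d → + 0 + + 8 * j * + 0 ≡ + 2 * + 0 * d + + 8 * (j - + 0 + + 1) * + 0
  vanish = solve-∀
corollary6p1 j (suc k) D _ = begin
  A j D (suc k) 1
    ≡⟨ A-linear j D (suc k) ⟩
  + 2 * + suc k * p (suc k) - + 8 * + k * p k + + 8 * + j * p k
    ≡⟨ cong₂ (λ a b → + 2 * + suc k * a - + 8 * + k * b + + 8 * + j * b)
         (polynomial≡coefficient D (suc k)) (polynomial≡coefficient D k) ⟩
  + 2 * + suc k * coefficient D (+ suc k) - + 8 * + k * coefficient D (+ k)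
    + + 8 * + j * coefficient D (+ k)
    -- The terms -8k and 8j combine to 8(j - (k + 1) + 1); the index `+ suc k - + 1` reduces to
    -- `+ k`.
    ≡⟨ collect (+ j) (+ k) (coefficient D (+ suc k)) (coefficient D (+ k)) ⟩
  + 2 * + suc k * coefficient D (+ suc k) + + 8 * (+ j - + suc k + + 1) * coefficient D (+ k) ∎
  where
  p : X.Series
  p = polynomial D

  collect : ∀ j k a b → + 2 * (+ 1 + k) * a - + 8 * k * b + + 8 * j * b
            ≡ + 2 * (+ 1 + k) * a + + 8 * (j - (+ 1 + k) + + 1) * b
  collect = solve-∀
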